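{- The integer $28$ is the only even perfect number that is a sum of two positive perfect cubes. That is, $28$ is an even perfect number with $28 = 3^3 + 1^3$, and if $n$ is an even perfect number such that $n = x^3 + a^3$ for some positive integers $x$ and $a$, then $n = 28$.
   Context: A positive integer $n$ is perfect if the sum of all its positive divisors (including $n$ itself) equals $2n$. -}

module Defs where

open import Data.List.Base using (List; applyUpTo; filter)
open import Data.Nat.Base using (ℕ; suc; _*_; _<_)
open import Data.Nat.Divisibility using (_∣_; _∣?_)
open import Data.Nat.ListAction using (sum)
open import Data.Product.Base using (_×_)
open import Relation.Binary.PropositionalEquality.Core using (_≡_)

-- applyUpTo suc n is the list 1, 2, …, n, so for n > 0 every positive divisor
-- of n is listed exactly once.
divisors : ℕ → List ℕ
divisors n = filter (_∣? n) (applyUpTo suc n)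

-- Positivity matters: 0 satisfies the equation vacuously.
Perfect : ℕ → Set
Perfect n = 0 < n × sum (divisors n) ≡ 2 * n

Even : ℕ → Set
Even n = 2 ∣ n

{-# OPTIONS --safe #-}
module Submission where

-- Splitting the divisors of 2ᵏm (m odd) by parity gives σ(2ᵏm) = (2ᵏ⁺¹ − 1) σ(m), so an even
-- perfect number is 2ᵏq with q = 2ᵏ⁺¹ − 1 prime (Euler). Suppose it equals x³ + a³ =
-- (x + a)(x² − xa + a²), and cancel factors 8 until x and a are not both even; this leaves a sum
-- of two cubes equal to 2ʲq with j ≤ k. The quadratic factor t is then odd, so t = 1 or t = q.
-- If t = 1, then x = a = 1, which is absurd. If t = q, then x + a = 2ʲ divides t + 1 = 2ᵏ⁺¹; as
-- a ≡ −x modulo 2ʲ, this says 2ʲ ∣ 3x² + 1, so j ≤ 2 because 3x² + 1 is never divisible by 8.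
-- Finally q + 3 ≤ (x + a)² ≤ 16 leaves only k = 2.

open import Defs
open import Data.Empty using (⊥)
open import Data.Fin.Base using (zero; suc)
open import Data.List.Base using (List; []; _∷_; _++_; map; applyUpTo)
open import Data.List.Membership.Propositional using (_∈_)
open import Data.List.Membership.Propositional.Properties
  using (∈-filter⁺; ∈-filter⁻; ∈-applyUpTo⁺; ∈-map⁺; ∈-map⁻; ∈-++⁺ˡ; ∈-++⁺ʳ; ∈-++⁻; ∈-∃++)
open import Data.List.Relation.Binary.Permutation.Propositional.Properties using (shift; ∈-resp-↭)
open import Data.List.Relation.Binary.Subset.Propositional using (_⊆_)
open import Data.List.Relation.Unary.All using ([]; _∷_)
open import Data.List.Relation.Unary.AllPairs using ([]; _∷_)
open import Data.List.Relation.Unary.Any using (here; there)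
open import Data.List.Relation.Unary.Unique.Propositional using (Unique)
import Data.List.Relation.Unary.Unique.Propositional.Properties as Unique
open import Data.Nat.Base
  using (ℕ; zero; suc; _+_; _*_; _^_; pred; _≤_; _<_; z≤n; s≤s; z<s; NonZero;
         >-nonZero; >-nonZero⁻¹)
open import Data.Nat.Coprimality using (Coprime; coprime-divisor)
open import Data.Nat.Divisibility
  using (_∣_; _∣?_; divides; ∣⇒≤; 0∣⇒≡0; ∣-trans; ∣-refl; 1∣_; ∣1⇒≡1; m∣m*n; n∣m*n; ∣n⇒∣m*n;
         ∣m⇒∣m*n; *-monoʳ-∣; *-cancelˡ-∣; ∣m+n∣m⇒∣n; ∣m∣n⇒∣m+n)
open import Data.Nat.DivMod using (_divMod_; result)
open import Data.Nat.Induction using (<-rec)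
open import Data.Nat.ListAction using (sum)
open import Data.Nat.ListAction.Properties using (sum-++; sum-↭)
open import Data.Nat.Primality using (Irreducible; irreducible[2])
open import Data.Nat.Properties
open import Data.Nat.Tactic.RingSolver using (solve-∀)
open import Data.Product.Base using (_×_; _,_; proj₂; ∃-syntax)
open import Data.Sum.Base using (_⊎_; inj₁; inj₂)
open import Relation.Binary.PropositionalEquality
  using (_≡_; _≢_; refl; sym; trans; cong; subst; module ≡-Reasoning)
open import Relation.Nullary using (¬_; yes; no; contradiction)
open import Relation.Nullary.Decidable using (from-no)

private
  variable
    d k m n q : ℕ

-- Divisor sums and the factor 2ᵏ

-- Delete from `ys` an occurrence of the head `x`; as `x` does not recur in `xs`, the tail still
-- lies in what is left. Applied in both directions, this equates the sums of duplicate-free lists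
-- with the same elements.
sum-mono-⊆ : {xs ys : List ℕ} → Unique xs → xs ⊆ ys → sum xs ≤ sum ys
sum-mono-⊆ {[]} _ _ = z≤n
sum-mono-⊆ {x ∷ xs} (x∉xs ∷ unique) xs⊆ys
  with us , vs , refl ← ∈-∃++ (xs⊆ys (here refl)) = begin
    x + sum xs          ≤⟨ +-monoʳ-≤ x (sum-mono-⊆ unique xs⊆us++vs) ⟩
    x + sum (us ++ vs)  ≡⟨ sum-↭ (shift x us vs) ⟨
    sum (us ++ x ∷ vs)  ∎
  where
  open ≤-Reasoning
  drop-x : ∀ {y zs} → y ∈ x ∷ zs → y ≢ x → y ∈ zs
  drop-x (here y≡x) y≢x = contradiction y≡x y≢x
  drop-x (there y∈zs) _ = y∈zs
  xs⊆us++vs : xs ⊆ us ++ vs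
  xs⊆us++vs y∈xs = drop-x (∈-resp-↭ (shift x us vs) (xs⊆ys (there y∈xs)))
    λ { refl → Unique.Unique[x∷xs]⇒x∉xs (x∉xs ∷ unique) y∈xs }

sum-map-* : ∀ c xs → sum (map (c *_) xs) ≡ c * sum xs
sum-map-* c []       = sym (*-zeroʳ c)
sum-map-* c (x ∷ xs) = trans (cong (c * x +_) (sum-map-* c xs)) (sym (*-distribˡ-+ c x (sum xs)))

divisors-unique : ∀ n → Unique (divisors n)
divisors-unique n = Unique.filter⁺ (_∣? n)
  (Unique.applyUpTo⁺₁ suc n λ i<j _ → <⇒≢ (s≤s i<j))

∈-divisors⁺ : 0 < n → d ∣ n → d ∈ divisors n
∈-divisors⁺ {n} {zero} 0<n 0∣n = contradiction (0∣⇒≡0 0∣n) (m<n⇒n≢0 0<n)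
∈-divisors⁺ {n} {suc i} 0<n d∣n =
  ∈-filter⁺ (_∣? n) (∈-applyUpTo⁺ suc (∣⇒≤ {{>-nonZero 0<n}} d∣n)) d∣n

∈-divisors⁻ : ∀ n → d ∈ divisors n → d ∣ n
∈-divisors⁻ n d∈ = proj₂ (∈-filter⁻ (_∣? n) {xs = applyUpTo suc n} d∈)

odd⇒coprime-2 : ¬ 2 ∣ d → Coprime d 2
odd⇒coprime-2 odd (i∣d , i∣2) with irreducible[2] i∣2
... | inj₁ i≡1  = i≡1
... | inj₂ refl = contradiction i∣d odd

odd-∣-2^*⇒∣ : ∀ k → ¬ 2 ∣ d → d ∣ 2 ^ k * m → d ∣ m
odd-∣-2^*⇒∣ {d} {m} zero odd d∣m = subst (d ∣_) (*-identityˡ m) d∣m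
odd-∣-2^*⇒∣ {d} {m} (suc k) odd d∣ = odd-∣-2^*⇒∣ k odd
  (coprime-divisor (odd⇒coprime-2 odd) (subst (d ∣_) (*-assoc 2 (2 ^ k) m) d∣))

0<2^k*m : ∀ k → 0 < m → 0 < 2 ^ k * m
0<2^k*m k 0<m = *-mono-≤ (>-nonZero⁻¹ (2 ^ k) {{m^n≢0 2 k}}) 0<m

-- The odd divisors of 2ᵏ⁺¹m are the divisors of m, and the even ones are the doubles of the
-- divisors of 2ᵏm.
σ-double : ∀ k → 0 < m → ¬ 2 ∣ m →
  sum (divisors (2 ^ suc k * m)) ≡ sum (divisors m) + 2 * sum (divisors (2 ^ k * m))
σ-double {m} k 0<m odd = begin
  sum (divisors (2 ^ suc k * m))
    ≡⟨ ≤-antisym (sum-mono-⊆ (divisors-unique (2 ^ suc k * m)) split) (sum-mono-⊆ parts-unique join) ⟩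
  sum (divisors m ++ map (2 *_) (divisors (2 ^ k * m)))
    ≡⟨ sum-++ (divisors m) _ ⟩
  sum (divisors m) + sum (map (2 *_) (divisors (2 ^ k * m)))
    ≡⟨ cong (sum (divisors m) +_) (sum-map-* 2 (divisors (2 ^ k * m))) ⟩
  sum (divisors m) + 2 * sum (divisors (2 ^ k * m)) ∎
  where
  open ≡-Reasoning
  parts : List ℕ
  parts = divisors m ++ map (2 *_) (divisors (2 ^ k * m))

  parts-unique : Unique parts
  parts-unique = Unique.++⁺ (divisors-unique m)
    (Unique.map⁺ (*-cancelˡ-≡ _ _ 2) (divisors-unique (2 ^ k * m)))
    λ (d∈m , d∈even) → case-even d∈m (∈-map⁻ (2 *_) d∈even)
    where
    case-even : d ∈ divisors m → ∃[ e ] e ∈ divisors (2 ^ k * m) × d ≡ 2 * e → ⊥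
    case-even d∈m (e , _ , refl) = odd (∣-trans (m∣m*n e) (∈-divisors⁻ m d∈m))

  split : divisors (2 ^ suc k * m) ⊆ parts
  split {d} d∈ with 2 ∣? d | ∈-divisors⁻ (2 ^ suc k * m) d∈
  ... | no d-odd | d∣ = ∈-++⁺ˡ (∈-divisors⁺ 0<m (odd-∣-2^*⇒∣ (suc k) d-odd d∣))
  ... | yes (divides e refl) | d∣ rewrite *-comm e 2 | *-assoc 2 (2 ^ k) m =
    ∈-++⁺ʳ (divisors m) (∈-map⁺ (2 *_) {x = e} (∈-divisors⁺ (0<2^k*m k 0<m) (*-cancelˡ-∣ 2 d∣)))

  join : parts ⊆ divisors (2 ^ suc k * m)
  join d∈ with ∈-++⁻ (divisors m) d∈
  ... | inj₁ d∈m = ∈-divisors⁺ (0<2^k*m (suc k) 0<m) (∣n⇒∣m*n (2 ^ suc k) (∈-divisors⁻ m d∈m))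
  ... | inj₂ d∈even with e , e∈ , refl ← ∈-map⁻ (2 *_) d∈even =
    ∈-divisors⁺ (0<2^k*m (suc k) 0<m)
      (subst (2 * e ∣_) (sym (*-assoc 2 (2 ^ k) m)) (*-monoʳ-∣ 2 (∈-divisors⁻ (2 ^ k * m) e∈)))

-- σ(2ᵏm) = (2ᵏ⁺¹ − 1) σ(m), without subtraction.
σ-2^k*odd : ∀ k → 0 < m → ¬ 2 ∣ m →
  sum (divisors (2 ^ k * m)) + sum (divisors m) ≡ 2 ^ suc k * sum (divisors m)
σ-2^k*odd {m} zero _ _ rewrite *-identityˡ m = sym (lemma (sum (divisors m)))
  where
  lemma : ∀ s → 2 * 1 * s ≡ s + s
  lemma = solve-∀
σ-2^k*odd {m} (suc k) 0<m odd rewrite σ-double k 0<m odd = begin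
  s + 2 * S + s      ≡⟨ rearrange s S ⟩
  2 * (S + s)        ≡⟨ cong (2 *_) (σ-2^k*odd k 0<m odd) ⟩
  2 * (2 ^ suc k * s) ≡⟨ *-assoc 2 (2 ^ suc k) s ⟨
  2 ^ suc (suc k) * s ∎
  where
  open ≡-Reasoning
  s = sum (divisors m)
  S = sum (divisors (2 ^ k * m))
  rearrange : ∀ s S → s + 2 * S + s ≡ 2 * (S + s)
  rearrange = solve-∀

-- Euler's form of even perfect numbers

OddPart : ℕ → Set
OddPart n = ∃[ k ] ∃[ m ] 0 < m × ¬ 2 ∣ m × n ≡ 2 ^ k * m

oddPart : ∀ n → 0 < n → OddPart n
oddPart = <-rec (λ n → 0 < n → OddPart n) step
  where
  step : ∀ n → (∀ {i} → i < n → 0 < i → OddPart i) → 0 < n → OddPart n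
  step n rec 0<n with 2 ∣? n
  ... | no odd = 0 , n , 0<n , odd , sym (*-identityˡ n)
  ... | yes (divides (suc i) refl)
    with k , m , 0<m , odd , eq ← rec (m<m*n (suc i) 2 (s≤s (s≤s z≤n))) z<s =
    suc k , m , 0<m , odd ,
    trans (*-comm (suc i) 2) (trans (cong (2 *_) eq) (sym (*-assoc 2 (2 ^ k) m)))

-- `Irreducible` also admits 1, but `0 < k` gives q ≥ 3, so here it means primality.
EuclidForm : ℕ → Set
EuclidForm n = ∃[ k ] ∃[ q ] 0 < k × n ≡ 2 ^ k * q × suc q ≡ 2 ^ suc k × Irreducible q

2∣2^suc : ∀ k → 2 ∣ 2 ^ suc k
2∣2^suc k = m∣m*n (2 ^ k)

3≤q : 0 < k → suc q ≡ 2 ^ suc k → 3 ≤ q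
3≤q {suc k} {q} _ eq = ≤-pred (subst (4 ≤_) (sym eq) (begin
  4                 ≡⟨⟩
  2 * (2 * 1)       ≤⟨ *-monoʳ-≤ 2 (*-monoʳ-≤ 2 (>-nonZero⁻¹ (2 ^ k) {{m^n≢0 2 k}})) ⟩
  2 * (2 * 2 ^ k)   ∎))
  where open ≤-Reasoning

-- If σ(m) = m + c with c a proper divisor of m, there is room for no third divisor.
irreducible-of-σ : ∀ m c → 0 < m → c ∣ m → m ≢ c → sum (divisors m) ≡ m + c →
  c ≡ 1 × Irreducible m
irreducible-of-σ m c 0<m c∣m m≢c σ≡ = c≡1 , irreducible
  where
  divisor-cases : d ∣ m → d ≡ m ⊎ d ≡ c
  divisor-cases {d} d∣m with d ≟ m | d ≟ c
  ... | yes d≡m | _ = inj₁ d≡m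
  ... | no _ | yes d≡c = inj₂ d≡c
  ... | no d≢m | no d≢c = contradiction 0≥d (<⇒≱ 0<d)
    where
    0<d : 0 < d
    0<d = n≢0⇒n>0 λ { refl → m<n⇒n≢0 0<m (0∣⇒≡0 d∣m) }
    three : d ∷ m ∷ c ∷ [] ⊆ divisors m
    three (here refl) = ∈-divisors⁺ 0<m d∣m
    three (there (here refl)) = ∈-divisors⁺ 0<m ∣-refl
    three (there (there (here refl))) = ∈-divisors⁺ 0<m c∣m
    0≥d : d ≤ 0
    0≥d = +-cancelʳ-≤ (m + c) d 0 (begin
      d + (m + c)        ≡⟨ cong (λ e → d + (m + e)) (+-identityʳ c) ⟨
      d + (m + (c + 0))  ≤⟨ sum-mono-⊆ ((d≢m ∷ d≢c ∷ []) ∷ (m≢c ∷ []) ∷ [] ∷ []) three ⟩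
      sum (divisors m)   ≡⟨ σ≡ ⟩
      m + c              ∎)
      where open ≤-Reasoning

  c≡1 : c ≡ 1
  c≡1 with divisor-cases (1∣ m)
  ... | inj₂ 1≡c = sym 1≡c
  ... | inj₁ 1≡m = ∣1⇒≡1 (subst (c ∣_) (sym 1≡m) c∣m)

  irreducible : Irreducible m
  irreducible d∣m with divisor-cases d∣m
  ... | inj₁ d≡m = inj₂ d≡m
  ... | inj₂ d≡c = inj₁ (trans d≡c c≡1)

m*n≢m : ∀ m n → 0 < m * n → 3 ≤ n → m * n ≢ m
m*n≢m (suc m) n _ 3≤n eq =
  <⇒≢ (m<m*n (suc m) n (≤-trans (s≤s (s≤s z≤n)) 3≤n)) (sym eq)

-- Since q is coprime to q + 1, it divides m. Putting m = cq and cancelling first s, then q, leaves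
-- s = (q + 1)c, that is, σ(m) = m + c when s = σ(m).
factor-of-σ-equation : ∀ q m s → 3 ≤ q → suc q * m + s ≡ suc q * s →
  ∃[ c ] m ≡ c * q × s ≡ c * q + c
factor-of-σ-equation q m s 3≤q eq with coprime-divisor {q} {suc q} {m} coprime q∣1+q*m
  where
  coprime : Coprime q (suc q)
  coprime {i} (i∣q , i∣1+q) = ∣1⇒≡1 (∣m+n∣m⇒∣n (subst (i ∣_) (+-comm 1 q) i∣1+q) i∣q)
  q∣1+q*m : q ∣ suc q * m
  q∣1+q*m = divides s (trans (+-cancelʳ-≡ s (suc q * m) (q * s) (trans eq (+-comm s (q * s)))) (*-comm q s))
... | divides c refl = c , refl , *-cancelˡ-≡ s (c * q + c) q {{>-nonZero (≤-trans (s≤s z≤n) 3≤q)}}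
    (sym (+-cancelʳ-≡ s (q * (c * q + c)) (q * s)
      (trans (cong (_+ s) (rearrange q c)) (trans eq (+-comm s (q * s))))))
  where
  rearrange : ∀ q c → q * (c * q + c) ≡ suc q * (c * q)
  rearrange = solve-∀

even-perfect⇒EuclidForm : ∀ n → Even n → Perfect n → EuclidForm n
even-perfect⇒EuclidForm n even (0<n , σn≡2n) with oddPart n 0<n
... | zero , m , _ , odd , refl = contradiction (subst (2 ∣_) (*-identityˡ m) even) odd
... | k@(suc _) , m , 0<m , odd , refl =
  fromFactor (factor-of-σ-equation p m (sum (divisors m)) p≥3 σ-equation)
  where
  p = pred (2 ^ suc k)
  1+p≡ : suc p ≡ 2 ^ suc k
  1+p≡ = suc-pred (2 ^ suc k) {{m^n≢0 2 (suc k)}}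
  p≥3 : 3 ≤ p
  p≥3 = 3≤q {k} z<s 1+p≡
  -- Perfection says σ(2ᵏm) = 2ᵏ⁺¹m, which replaces the first term of `σ-2^k*odd`.
  σ-equation : suc p * m + sum (divisors m) ≡ suc p * sum (divisors m)
  σ-equation = subst (λ P → P * m + sum (divisors m) ≡ P * sum (divisors m)) (sym 1+p≡)
    (trans (cong (_+ sum (divisors m)) (trans (*-assoc 2 (2 ^ k) m) (sym σn≡2n)))
      (σ-2^k*odd k 0<m odd))
  fromFactor : (∃[ c ] m ≡ c * p × sum (divisors m) ≡ c * p + c) → EuclidForm (2 ^ k * m)
  fromFactor (c , refl , σm≡)
    -- Matching c = 1 turns m into `1 * p`, which computes to `p + 0`.
    with refl , irreducible ← irreducible-of-σ (c * p) c 0<m (m∣m*n p) (m*n≢m c p 0<m p≥3) σm≡ =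
    k , p , z<s , cong (2 ^ k *_) (+-identityʳ p) , 1+p≡ , subst Irreducible (+-identityʳ p) irreducible

-- Factoring a sum of two cubes

-- This is x² - xa + a² for a = x + d; using the difference `d` avoids subtraction.
quad : ℕ → ℕ → ℕ
quad x d = x * x + x * d + d * d

-- x³ + a³ = (x + a)(x² − xa + a²) with a = x + d.
sum-of-cubes : ∀ x d → x ^ 3 + (x + d) ^ 3 ≡ (2 * x + d) * quad x d
-- `expanded` is the same identity by computation, with powers and `quad` spelled out for the ring
-- solver.
sum-of-cubes = expanded
  where
  expanded : ∀ x d → x * (x * (x * 1)) + (x + d) * ((x + d) * ((x + d) * 1))
           ≡ (2 * x + d) * (x * x + x * d + d * d)
  expanded = solve-∀

sum-of-doubled-cubes : ∀ x d → (x * 2) ^ 3 + (x * 2 + d * 2) ^ 3 ≡ 8 * (x ^ 3 + (x + d) ^ 3)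
sum-of-doubled-cubes = expanded
  where
  expanded : ∀ x d →
    x * 2 * (x * 2 * (x * 2 * 1)) + (x * 2 + d * 2) * ((x * 2 + d * 2) * ((x * 2 + d * 2) * 1))
    ≡ 8 * (x * (x * (x * 1)) + (x + d) * ((x + d) * ((x + d) * 1)))
  expanded = solve-∀

-- The excess is 3xa, at least 3 for positive x and a; this bounds q + 3 by (x + a)².
square≡quad+ : ∀ x d → (2 * x + d) * (2 * x + d) ≡ quad x d + 3 * (x * (x + d))
square≡quad+ = expanded
  where
  expanded : ∀ x d → (2 * x + d) * (2 * x + d) ≡ x * x + x * d + d * d + 3 * (x * (x + d))
  expanded = solve-∀

-- quad x d ≡ 3x² modulo 2x + d, without subtraction.
quad-mod-sum : ∀ x d →
  suc (quad x d) + (2 * x + d) * (3 * x) ≡ (2 * x + d) * (2 * x + d) + (3 * (x * x) + 1)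
quad-mod-sum = expanded
  where
  expanded : ∀ x d → suc (x * x + x * d + d * d) + (2 * x + d) * (3 * x)
           ≡ (2 * x + d) * (2 * x + d) + (3 * (x * x) + 1)
  expanded = solve-∀

∤-remainder : ∀ {r} → ¬ d ∣ r → ∀ z → n ≡ d * z + r → ¬ d ∣ n
∤-remainder d∤r z refl d∣n = d∤r (∣m+n∣m⇒∣n d∣n (m∣m*n z))

-- The residue of x modulo 4 fixes x² modulo 8; the four cases leave 1, 4, 13 and 28, none divisible
-- by 8.
8∤3x²+1 : ∀ x → ¬ 8 ∣ 3 * (x * x) + 1
8∤3x²+1 x with x divMod 4
... | result z zero refl = ∤-remainder (from-no (8 ∣? 1)) (6 * (z * z)) (expand z)
  where
  expand : ∀ z → 3 * ((z * 4) * (z * 4)) + 1 ≡ 8 * (6 * (z * z)) + 1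
  expand = solve-∀
... | result z (suc zero) refl = ∤-remainder (from-no (8 ∣? 4)) (6 * (z * z) + 3 * z) (expand z)
  where
  expand : ∀ z → 3 * ((1 + z * 4) * (1 + z * 4)) + 1 ≡ 8 * (6 * (z * z) + 3 * z) + 4
  expand = solve-∀
... | result z (suc (suc zero)) refl = ∤-remainder (from-no (8 ∣? 13)) (6 * (z * z) + 6 * z) (expand z)
  where
  expand : ∀ z → 3 * ((2 + z * 4) * (2 + z * 4)) + 1 ≡ 8 * (6 * (z * z) + 6 * z) + 13
  expand = solve-∀
... | result z (suc (suc (suc zero))) refl =
  ∤-remainder (from-no (8 ∣? 28)) (6 * (z * z) + 9 * z) (expand z)
  where
  expand : ∀ z → 3 * ((3 + z * 4) * (3 + z * 4)) + 1 ≡ 8 * (6 * (z * z) + 9 * z) + 28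
  expand = solve-∀

-- Modulo 2, the form x² + xd + d² vanishes only at (0, 0).
2∣quad⇒2∣both : ∀ x d → 2 ∣ quad x d → 2 ∣ x × 2 ∣ d
2∣quad⇒2∣both x d 2∣t with x divMod 2 | d divMod 2
... | result y zero refl | result e zero refl = n∣m*n y , n∣m*n e
... | result y zero refl | result e (suc zero) refl =
  contradiction 2∣t (∤-remainder (from-no (2 ∣? 1)) (2 * y * y + y * (1 + e * 2) + 2 * e * e + 2 * e) (expand y e))
  where
  expand : ∀ y e → (y * 2) * (y * 2) + (y * 2) * (1 + e * 2) + (1 + e * 2) * (1 + e * 2)
         ≡ 2 * (2 * y * y + y * (1 + e * 2) + 2 * e * e + 2 * e) + 1
  expand = solve-∀
... | result y (suc zero) refl | result e zero refl =
  contradiction 2∣t (∤-remainder (from-no (2 ∣? 1)) (2 * y * y + 2 * y + (1 + y * 2) * e + 2 * e * e) (expand y e))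
  where
  expand : ∀ y e → (1 + y * 2) * (1 + y * 2) + (1 + y * 2) * (e * 2) + (e * 2) * (e * 2)
         ≡ 2 * (2 * y * y + 2 * y + (1 + y * 2) * e + 2 * e * e) + 1
  expand = solve-∀
... | result y (suc zero) refl | result e (suc zero) refl =
  contradiction 2∣t (∤-remainder (from-no (2 ∣? 3))
    (2 * y * y + 3 * y + 3 * e + 2 * y * e + 2 * e * e) (expand y e))
  where
  expand : ∀ y e → (1 + y * 2) * (1 + y * 2) + (1 + y * 2) * (1 + e * 2) + (1 + e * 2) * (1 + e * 2)
         ≡ 2 * (2 * y * y + 3 * y + 3 * e + 2 * y * e + 2 * e * e) + 3
  expand = solve-∀

quad≡1 : ∀ x d → 0 < x → quad x d ≡ 1 → x ≡ 1 × d ≡ 0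
quad≡1 (suc zero) zero _ _ = refl , refl
quad≡1 (suc zero) (suc d) _ ()
quad≡1 (suc (suc x)) d _ ()

8∣2^3+ : ∀ i → 8 ∣ 2 ^ (3 + i)
8∣2^3+ i = subst (8 ∣_) (sym (^-distribˡ-+-* 2 3 i)) (m∣m*n (2 ^ i))

-- Sums of two cubes equal to 2ʲq

module _ (0<k : 0 < k) (1+q≡ : suc q ≡ 2 ^ suc k) (irreducible : Irreducible q) where

  q≥3 : 3 ≤ q
  q≥3 = 3≤q 0<k 1+q≡

  instance
    q≢0 : NonZero q
    q≢0 = >-nonZero (≤-trans (s≤s z≤n) q≥3)

  q-odd : ¬ 2 ∣ q
  q-odd 2∣q = from-no (2 ∣? 1) (∣m+n∣m⇒∣n (subst (2 ∣_) (trans (sym 1+q≡) (+-comm 1 q)) (2∣2^suc k)) 2∣q)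

  -- Size settles j ≤ 2, and divisibility by 8 excludes j ≥ 3.
  quad≡q-case : ∀ j x d → 0 < x → j ≤ k → 2 * x + d ≡ 2 ^ j → quad x d ≡ q → k ≡ 2
  quad≡q-case j x d 0<x j≤k s≡ t≡ = go j j≤k s≡
    where
    q+3≤s² : q + 3 ≤ (2 * x + d) * (2 * x + d)
    q+3≤s² = begin
      q + 3                         ≡⟨ cong (_+ 3) t≡ ⟨
      quad x d + 3 * 1              ≤⟨ +-monoʳ-≤ (quad x d) (*-monoʳ-≤ 3 (*-mono-≤ 0<x (≤-trans 0<x (m≤m+n x d)))) ⟩
      quad x d + 3 * (x * (x + d))  ≡⟨ square≡quad+ x d ⟨
      (2 * x + d) * (2 * x + d)     ∎
      where open ≤-Reasoning

    q+3≤ : ∀ {s} → 2 * x + d ≡ s → q + 3 ≤ s * s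
    q+3≤ refl = q+3≤s²

    go : ∀ j → j ≤ k → 2 * x + d ≡ 2 ^ j → k ≡ 2
    -- For j = 0 and j = 1 the square is 1 or 4, but q + 3 ≥ 6.
    go 0 _ s≡1 = contradiction (≤-trans (+-monoˡ-≤ 3 q≥3) (q+3≤ s≡1)) (from-no (6 ≤? 1))
    go 1 _ s≡2 = contradiction (≤-trans (+-monoˡ-≤ 3 q≥3) (q+3≤ s≡2)) (from-no (6 ≤? 4))
    go 2 2≤k s≡4 with m≤n⇒∃[o]m+o≡n 2≤k
    ... | zero , refl = refl
    -- Here k = 3 + i, so q + 1 is at least 16, while q + 3 ≤ 4² gives q + 1 ≤ 14.
    ... | suc i , refl = contradiction (begin
        16                ≤⟨ ∣⇒≤ {{m^n≢0 2 (4 + i)}} (subst (16 ∣_) (sym (^-distribˡ-+-* 2 4 i)) (m∣m*n (2 ^ i))) ⟩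
        2 ^ (4 + i)       ≡⟨ 1+q≡ ⟨
        suc q             ≤⟨ +-cancelʳ-≤ 2 (suc q) 14 (subst (_≤ 16) (+-suc q 2) (q+3≤ s≡4)) ⟩
        14                ∎) (from-no (16 ≤? 14))
      where open ≤-Reasoning
    go (suc (suc (suc i))) j≤k s≡ with l , refl ← m≤n⇒∃[o]m+o≡n j≤k =
      -- In `quad-mod-sum` every term except 3x² + 1 is a multiple of 8.
      contradiction (∣m+n∣m⇒∣n (subst (8 ∣_) (quad-mod-sum x d) (∣m∣n⇒∣m+n 8∣1+t (∣m⇒∣m*n (3 * x) 8∣s)))
        (∣m⇒∣m*n (2 * x + d) 8∣s)) (8∤3x²+1 x)
      where
      8∣s : 8 ∣ 2 * x + d
      8∣s = subst (8 ∣_) (sym s≡) (8∣2^3+ i)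
      8∣1+t : 8 ∣ suc (quad x d)
      -- Since k = 3 + i + l, the exponent of q + 1 is 3 + (1 + i + l).
      8∣1+t = subst (8 ∣_) (sym (trans (cong suc t≡) 1+q≡)) (8∣2^3+ (suc (i + l)))

  -- The quadratic factor is odd and divides 2ʲq, hence divides the irreducible q.
  primitive-case : ∀ j x d → 0 < x → j ≤ k → ¬ (2 ∣ x × 2 ∣ d) →
    x ^ 3 + (x + d) ^ 3 ≡ 2 ^ j * q → k ≡ 2
  primitive-case j x d 0<x j≤k notBothEven eq
    with irreducible (odd-∣-2^*⇒∣ j (λ 2∣t → notBothEven (2∣quad⇒2∣both x d 2∣t)) t∣)
    where
    t∣ : quad x d ∣ 2 ^ j * q
    t∣ = divides (2 * x + d) (trans (sym eq) (sum-of-cubes x d))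
  ... | inj₂ t≡q = quad≡q-case j x d 0<x j≤k
    (*-cancelʳ-≡ (2 * x + d) (2 ^ j) q
      (trans (cong ((2 * x + d) *_) (sym t≡q)) (trans (sym (sum-of-cubes x d)) eq))) t≡q
  -- Now x = a = 1, so 2 = 2ʲq and q divides 2, against q ≥ 3.
  ... | inj₁ t≡1 with refl , refl ← quad≡1 x d 0<x t≡1 =
    contradiction (≤-trans q≥3 (∣⇒≤ (divides (2 ^ j) eq))) (from-no (3 ≤? 2))

  -- The exponent `j` is separate from `k` for the descent: halving x and d lowers `j` by 3 and
  -- keeps q and `k`.
  cubes⇒k≡2 : ∀ j x d → 0 < x → j ≤ k → x ^ 3 + (x + d) ^ 3 ≡ 2 ^ j * q → k ≡ 2
  cubes⇒k≡2 j x d 0<x j≤k eq with 2 ∣? x | 2 ∣? d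
  ... | no odd | _      = primitive-case j x d 0<x j≤k (λ (2∣x , _) → odd 2∣x) eq
  ... | _      | no odd = primitive-case j x d 0<x j≤k (λ (_ , 2∣d) → odd 2∣d) eq
  ... | yes (divides (suc y) refl) | yes (divides e refl) =
    descend j j≤k (trans (sym (sum-of-doubled-cubes (suc y) e)) eq)
    where
    N = suc y ^ 3 + (suc y + e) ^ 3
    -- 8 N = 2ʲ q with q odd forces j ≥ 3.
    descend : ∀ j → j ≤ k → 8 * N ≡ 2 ^ j * q → k ≡ 2
    descend 0 _ eq = contradiction (subst (2 ∣_) (trans eq (*-identityˡ q)) (∣m⇒∣m*n N (divides 4 refl))) q-odd
    descend 1 _ eq = contradiction (*-cancelˡ-∣ 2 (subst (4 ∣_) eq (∣m⇒∣m*n N (divides 2 refl)))) q-odd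
    descend 2 _ eq = contradiction (*-cancelˡ-∣ 4 (subst (8 ∣_) eq (m∣m*n N))) q-odd
    descend (suc (suc (suc i))) j≤k eq = cubes⇒k≡2 i (suc y) e z<s (≤-trans (m≤n+m i 3) j≤k)
      (*-cancelˡ-≡ N (2 ^ i * q) 8
        (trans eq (trans (cong (_* q) (^-distribˡ-+-* 2 3 i)) (*-assoc 8 (2 ^ i) q))))

-- Conclusion

ordered-case : ∀ n x d → Even n → Perfect n → 0 < x → n ≡ x ^ 3 + (x + d) ^ 3 → n ≡ 28
ordered-case n x d even perfect 0<x n≡
  with k , q , 0<k , n≡2^k*q , 1+q≡ , irreducible ← even-perfect⇒EuclidForm n even perfect
  with refl ← cubes⇒k≡2 0<k 1+q≡ irreducible k x d 0<x ≤-refl (trans (sym n≡) n≡2^k*q)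
  -- With k = 2 this gives q = 7, and `2 ^ 2 * 7` computes to 28.
  with refl ← 1+q≡ = n≡2^k*q

mainTheorem1 : (Even 28 × Perfect 28 × 28 ≡ 3 ^ 3 + 1 ^ 3)
    × (∀ (n x a : ℕ) → Even n → Perfect n → 0 < x → 0 < a →
    n ≡ x ^ 3 + a ^ 3 → n ≡ 28)
mainTheorem1 = (divides 14 refl , (z<s , refl) , refl) , unique
  where
  unique : ∀ (n x a : ℕ) → Even n → Perfect n → 0 < x → 0 < a → n ≡ x ^ 3 + a ^ 3 → n ≡ 28
  -- By symmetry the smaller root may come first, the other being it plus `d`.
  unique n x a even perfect 0<x 0<a n≡ with ≤-total x a
  ... | inj₁ x≤a with d , refl ← m≤n⇒∃[o]m+o≡n x≤a = ordered-case n x d even perfect 0<x n≡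
  ... | inj₂ a≤x with d , refl ← m≤n⇒∃[o]m+o≡n a≤x =
    ordered-case n a d even perfect 0<a (trans n≡ (+-comm ((a + d) ^ 3) (a ^ 3)))
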